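{- For every $M\ge \frac52$, every deterministic semi-online algorithm with migration factor $M$ for scheduling on two hierarchical machines with known optimal makespan (bin stretching) has competitive ratio at least $1+\frac{2}{2M+3}=\frac{2M+5}{2M+3}$.
   Context: Model (two hierarchical machines with migration, bin stretching). Jobs $1,2,\dots,n$ arrive one by one ($n$ unknown in advance). Job $j$ has a size $p_j>0$ and a grade of service (GoS) $g_j\in\{1,2\}$; a job of GoS $1$ may only be processed on machine $m_1$, a job of GoS $2$ may be processed on $m_1$ or on $m_2$. The load of a machine is the total size of the jobs assigned to it, and the makespan is the maximum load. When job $j$ arrives, the algorithm must assign it to a machine, and at the same time it may reassign (migrate) previously arrived jobs to other machines (respecting the GoS constraints), provided that the total size of the migrated jobs is at most $M\cdot p_j$; $M\ge 0$ is the migration factor. Bin stretching: the optimal offline makespan of the complete input is known in advance to the algorithm (and scaled to $1$). The competitive ratio of an algorithm is the supremum over inputs of (algorithm's makespan)/(optimal makespan). -}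

module Defs where

open import Level using (Level) renaming (suc to lsuc; _⊔_ to _⊔ˡ_)
open import Algebra.Core using (Op₁; Op₂)
open import Algebra.Apartness.Bundles using (HeytingField; HeytingCommutativeRing)
open import Algebra.Apartness.Structures using (IsHeytingField)
import Algebra.Apartness.Properties.HeytingCommutativeRing as HCRProperties
import Algebra.Properties.Ring as RingProperties
open import Algebra.Bundles using (CommutativeRing)
open import Data.Bool.Base using (if_then_else_)
open import Data.Empty using (⊥-elim)
open import Data.List.Base using (List; []; _∷_; _++_)
open import Data.List.Relation.Unary.All using (All; []; _∷_; tail)
open import Data.Product.Base using (Σ; ∃; ∃-syntax; _×_; _,_; proj₁; proj₂)
open import Data.Sum.Base using (_⊎_; inj₁; inj₂; [_,_]′)
open import Relation.Binary.Core using (Rel)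
open import Relation.Binary.Definitions using (DecidableEquality)
open import Relation.Binary.Lattice.Definitions using (Supremum)
open import Relation.Binary.PropositionalEquality.Core using (_≡_) renaming (refl to ≡-refl)
open import Relation.Binary.Structures using (IsStrictPartialOrder)
open import Relation.Nullary.Decidable.Core using (Dec; yes; no; does)
open import Relation.Nullary.Negation.Core using (¬_)

-- The standard library has no real numbers, so quantities live in an arbitrary
-- ordered field.  The axioms are the constructive ones: x ≤ y means ¬ (y < x),
-- and < is cotransitive instead of trichotomous (this is the cotransitivity of
-- the apartness x < y ⊎ y < x).  Hence ℚ, the classical reals and the
-- constructive (Cauchy or Dedekind) reals are all models.

record OrderedField c ℓ₁ ℓ₂ : Set (lsuc (c ⊔ˡ ℓ₁ ⊔ˡ ℓ₂)) where
  infix  8 -_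
  infixl 7 _*_
  infixl 6 _+_ _⊔_
  infix  4 _≈_ _<_ _≤_ _#_
  field
    Carrier : Set c
    _≈_     : Rel Carrier ℓ₁
    _<_     : Rel Carrier ℓ₂
    _+_     : Op₂ Carrier
    _*_     : Op₂ Carrier
    _⊔_     : Op₂ Carrier
    -_      : Op₁ Carrier
    0#      : Carrier
    1#      : Carrier

  _#_ : Rel Carrier ℓ₂
  x # y = x < y ⊎ y < x

  _≤_ : Rel Carrier ℓ₂
  x ≤ y = ¬ (y < x)

  field
    isHeytingField       : IsHeytingField _≈_ _#_ _+_ _*_ -_ 0# 1#
    isStrictPartialOrder : IsStrictPartialOrder _≈_ _<_
    +-monoˡ-<            : ∀ z {x y} → x < y → x + z < y + z
    *-pos                : ∀ {x y} → 0# < x → 0# < y → 0# < x * y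
    ⊔-supremum           : Supremum _≤_ _⊔_

  heytingField : HeytingField c ℓ₁ ℓ₂
  heytingField = record { isHeytingField = isHeytingField }

  open HeytingField heytingField public
    using (heytingCommutativeRing)
  open IsHeytingField isHeytingField public
    hiding (isEquivalence)
  open IsStrictPartialOrder isStrictPartialOrder public
    using (<-respʳ-≈; <-respˡ-≈)
    renaming (irrefl to <-irrefl; trans to <-trans; asym to <-asym)
  open HeytingCommutativeRing heytingCommutativeRing public
    using (commutativeRing)

  private
    module HP = HCRProperties heytingCommutativeRing
    module RP = RingProperties (CommutativeRing.ring commutativeRing)

  <-cotrans : ∀ {x y} → x < y → ∀ z → x < z ⊎ z < y
  <-cotrans x<y z with #-cotrans (inj₁ x<y) z
  ... | inj₁ (inj₁ x<z) = inj₁ x<z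
  ... | inj₁ (inj₂ z<x) = inj₂ (<-trans z<x x<y)
  ... | inj₂ (inj₁ z<y) = inj₂ z<y
  ... | inj₂ (inj₂ y<z) = inj₁ (<-trans x<y y<z)

  <-≤-trans : ∀ {x y z} → x < y → y ≤ z → x < z
  <-≤-trans {z = z} x<y y≤z = [ (λ x<z → x<z) , (λ z<y → ⊥-elim (y≤z z<y)) ]′ (<-cotrans x<y z)

  +-pos : ∀ {x y} → 0# < x → 0# < y → 0# < x + y
  +-pos {x} {y} 0<x 0<y =
    <-trans 0<y (<-respˡ-≈ (+-identityˡ y) (+-monoˡ-< y 0<x))

  x<0⇒0<-x : ∀ {x} → x < 0# → 0# < - x
  x<0⇒0<-x {x} x<0 =
    <-respʳ-≈ (+-identityˡ (- x)) (<-respˡ-≈ (-‿inverseʳ x) (+-monoˡ-< (- x) x<0))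

  0<1# : 0# < 1#
  0<1# with HP.1#0
  ... | inj₂ 0<1 = 0<1
  ... | inj₁ 1<0 = <-respʳ-≈ [-1]²≈1 (*-pos 0<-1 0<-1)
    where
    0<-1 = x<0⇒0<-x 1<0
    [-1]²≈1 : - 1# * - 1# ≈ 1#
    [-1]²≈1 = trans (RP.-1*x≈-x (- 1#)) (RP.-‿involutive 1#)

  inverse : ∀ y → 0# < y → Carrier
  inverse y 0<y = proj₁ (#⇒invertible {y} {0#} (inj₂ 0<y))

  inverseˡ : ∀ y (0<y : 0# < y) → inverse y 0<y * y ≈ 1#
  inverseˡ y 0<y =
    trans (*-congˡ (sym (HP.x-0≈x y))) (proj₁ (proj₂ (#⇒invertible {y} {0#} (inj₂ 0<y))))

  inverse-pos : ∀ y (0<y : 0# < y) → 0# < inverse y 0<y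
  inverse-pos y 0<y with HP.invertibleʳ⇒# {inverse y 0<y} {0#}
                           (y , trans (*-congʳ (HP.x-0≈x _)) (inverseˡ y 0<y))
  ... | inj₂ 0<i = 0<i
  ... | inj₁ i<0 = ⊥-elim (<-asym 0<1# 1<0)
    where
    i = inverse y 0<y
    0<-1 : 0# < - 1#
    0<-1 = <-respʳ-≈ (trans (sym (RP.-‿distribˡ-* i y)) (-‿cong (inverseˡ y 0<y)))
                     (*-pos (x<0⇒0<-x i<0) 0<y)
    1<0 : 1# < 0#
    1<0 = <-respʳ-≈ (-‿inverseˡ 1#) (<-respˡ-≈ (+-identityˡ 1#) (+-monoˡ-< 1# 0<-1))

  infixl 7 _/_[_]
  _/_[_] : (x y : Carrier) → 0# < y → Carrier
  x / y [ 0<y ] = x * inverse y 0<y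

  2# 3# 5# : Carrier
  2# = 1# + 1#
  3# = 2# + 1#
  5# = 3# + 2#

  0<2# : 0# < 2#
  0<2# = +-pos 0<1# 0<1#

  0<3# : 0# < 3#
  0<3# = +-pos 0<2# 0<1#

  5/2 : Carrier
  5/2 = 5# / 2# [ 0<2# ]

  0<2M+3 : ∀ {M} → 5/2 ≤ M → 0# < 2# * M + 3#
  0<2M+3 5/2≤M = +-pos (*-pos 0<2# (<-≤-trans 0<5/2 5/2≤M)) 0<3#
    where
    0<5/2 : 0# < 5/2
    0<5/2 = *-pos (+-pos 0<3# 0<2#) (inverse-pos 2# 0<2#)

data Machine : Set where
  m₁ m₂ : Machine

data GoS : Set where
  gos₁ gos₂ : GoS

data _CanProcess_ : Machine → GoS → Set where
  m₁-any : ∀ {g} → m₁ CanProcess g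
  m₂-two : m₂ CanProcess gos₂

_≟_ : DecidableEquality Machine
m₁ ≟ m₁ = yes ≡-refl
m₁ ≟ m₂ = no λ ()
m₂ ≟ m₁ = no λ ()
m₂ ≟ m₂ = yes ≡-refl

module Scheduling {c ℓ₁ ℓ₂} (F : OrderedField c ℓ₁ ℓ₂) where
  open OrderedField F

  record Job : Set (c ⊔ˡ ℓ₂) where
    constructor job
    field
      size     : Carrier
      size-pos : 0# < size
      gos      : GoS

  open Job public

  -- Most recent arrival first: `j ∷ js` is the sequence js followed by the
  -- arrival of j, and `ks ++ js` is a continuation of js.
  Jobs : Set (c ⊔ˡ ℓ₂)
  Jobs = List Job

  Schedule : Jobs → Set (c ⊔ˡ ℓ₂)
  Schedule = All (λ j → ∃[ m ] m CanProcess gos j)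

  load : Machine → ∀ {js} → Schedule js → Carrier
  load m []                        = 0#
  load m (_∷_ {x = j} (m′ , _) σ) = (if does (m ≟ m′) then size j else 0#) + load m σ

  makespan : ∀ {js} → Schedule js → Carrier
  makespan σ = load m₁ σ ⊔ load m₂ σ

  -- Total size of the jobs that the two schedules put on different machines.
  migrated : ∀ {js} → Schedule js → Schedule js → Carrier
  migrated []                       []             = 0#
  migrated (_∷_ {x = j} (m , _) σ) ((m′ , _) ∷ τ) =
    (if does (m ≟ m′) then 0# else size j) + migrated σ τ

  IsOptimalMakespan : Jobs → Carrier → Set (c ⊔ˡ ℓ₁ ⊔ˡ ℓ₂)
  IsOptimalMakespan js t =
    (Σ (Schedule js) λ σ → makespan σ ≈ t) × (∀ (σ : Schedule js) → t ≤ makespan σ)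

  -- Bin stretching: the complete inputs are those with optimal makespan 1.
  CompleteInput : Jobs → Set (c ⊔ˡ ℓ₁ ⊔ˡ ℓ₂)
  CompleteInput js = IsOptimalMakespan js 1#

  -- A deterministic algorithm chooses its current schedule from the jobs seen
  -- so far.  Its migration is only constrained on sequences that can occur,
  -- i.e. that extend to a complete input.
  record Algorithm (M : Carrier) : Set (c ⊔ˡ ℓ₁ ⊔ˡ ℓ₂) where
    field
      schedule          : ∀ js → Schedule js
      migration-bounded : ∀ j js → (∃[ ks ] CompleteInput (ks ++ j ∷ js)) →
                          migrated (schedule js) (tail (schedule (j ∷ js))) ≤ M * size j

  open Algorithm public

  -- The supremum of makespan / optimum over complete inputs is at least r, in
  -- the sense that every x < r is exceeded by some ratio; this includes an
  -- infinite supremum.  The optimum is 1, so the ratio is the makespan itself.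
  CompetitiveRatio_AtLeast_ : ∀ {M} → Algorithm M → Carrier → Set (c ⊔ˡ ℓ₁ ⊔ˡ ℓ₂)
  CompetitiveRatio A AtLeast r =
    ∀ x → x < r → ∃[ js ] CompleteInput js × x < makespan (schedule A js)

{-# OPTIONS --safe #-}
module Submission where

import Algebra.Properties.CommutativeSemigroup as CommutativeSemigroupProperties
import Algebra.Properties.Semiring.Mult as SemiringMult
import Algebra.Solver.Ring.NaturalCoefficients.Default as SemiringSolver
open import Algebra.Bundles using (CommutativeRing)
open import Data.Bool.Base using (if_then_else_)
open import Data.Empty using (⊥-elim)
open import Data.List.Base using ([]; _∷_)
open import Data.List.Relation.Unary.All using (All; []; _∷_; tail)
open import Data.Nat.Base as ℕ using (ℕ; zero; suc; NonZero; z≤n; s≤s)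
import Data.Nat.Properties as ℕ
open import Data.Product.Base using (∃-syntax; _×_; _,_; proj₁; proj₂)
open import Data.Sum.Base using (_⊎_; inj₁; inj₂; [_,_]′)
open import Level using () renaming (_⊔_ to _⊔ˡ_)
open import Relation.Binary.PropositionalEquality.Core
  using (_≡_; cong; cong₂; subst) renaming (refl to ≡-refl; trans to ≡-trans)
open import Relation.Nullary.Decidable.Core using (Dec; True; toWitness; does; _×-dec_)
open import Relation.Nullary.Negation.Core using (¬_)
open import Defs

-- Put e slightly below 2/(2M+3).  After a GoS 1 job of size e and GoS 2 jobs of
-- sizes 1-2e and 1-e, the adversary looks at the current schedule.  If 1-2e is
-- on m₁ and 1-e on m₂, then a GoS 2 job of size 2e arrives: the optimum now
-- swaps the two, but 2Me < 2-3e, so they cannot both move and the makespan is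
-- at least 1+e.  Otherwise two GoS 1 jobs of size e/2 arrive, each too small to
-- move anything, and the makespan is again at least 1+e; when both GoS 2 jobs
-- share m₂ this is 2-3e ≥ 1+e, which is where M ≥ 5/2 enters (through 4e ≤ 1).

-- Order and arithmetic in a constructive ordered field.

module OrderedFieldProperties {c ℓ₁ ℓ₂} (F : OrderedField c ℓ₁ ℓ₂) where
  open OrderedField F
  open CommutativeRing commutativeRing using (commutativeSemiring; semiring)
  open SemiringSolver commutativeSemiring public using (Polynomial; solve; _:=_; _:+_; _:*_; _:×_; con)

  private variable
    x y z w : Carrier

  <⇒≤ : x < y → x ≤ y
  <⇒≤ x<y y<x = <-asym x<y y<x

  ≤-<-trans : x ≤ y → y < z → x < z
  ≤-<-trans {x = x} x≤y y<z = [ (λ y<x → ⊥-elim (x≤y y<x)) , (λ x<z → x<z) ]′ (<-cotrans y<z x)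

  ≤-trans : x ≤ y → y ≤ z → x ≤ z
  ≤-trans x≤y y≤z z<x = y≤z (<-≤-trans z<x x≤y)

  ≤-reflexive : x ≈ y → x ≤ y
  ≤-reflexive x≈y y<x = <-irrefl (sym x≈y) y<x

  ≤-antisym : x ≤ y → y ≤ x → x ≈ y
  ≤-antisym {x} {y} x≤y y≤x = proj₁ (tight x y) [ y≤x , x≤y ]′

  +-monoʳ-< : ∀ z → x < y → z + x < z + y
  +-monoʳ-< z x<y = <-respʳ-≈ (+-comm _ z) (<-respˡ-≈ (+-comm _ z) (+-monoˡ-< z x<y))

  +-mono-< : x < y → z < w → x + z < y + w
  +-mono-< x<y z<w = <-trans (+-monoˡ-< _ x<y) (+-monoʳ-< _ z<w)

  +-cancelʳ-< : ∀ z → x + z < y + z → x < y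
  +-cancelʳ-< z lt = <-respʳ-≈ (cancel _) (<-respˡ-≈ (cancel _) (+-monoˡ-< (- z) lt))
    where
    cancel : ∀ u → u + z + - z ≈ u
    cancel u = trans (+-assoc u z (- z)) (trans (+-congˡ (-‿inverseʳ z)) (+-identityʳ u))

  +-mono-≤ : x ≤ y → z ≤ w → x + z ≤ y + w
  +-mono-≤ {x} {y} {z} {w} x≤y z≤w yw<xz = x≤y (+-cancelʳ-< z (≤-<-trans y+z≤y+w yw<xz))
    where
    y+z≤y+w : y + z ≤ y + w
    y+z≤y+w lt = z≤w (+-cancelʳ-< y (<-respʳ-≈ (+-comm y z) (<-respˡ-≈ (+-comm y w) lt)))

  -- Cotransitivity places `x + y` relative to `x + x < y + y`: it lies above the left end or below
  -- the right end, and either way one summand cancels.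
  double-cancel-< : x + x < y + y → x < y
  double-cancel-< {x} {y} lt =
    [ (λ lt′ → +-cancelʳ-< x (<-respʳ-≈ (+-comm x y) lt′)) , +-cancelʳ-< y ]′ (<-cotrans lt (x + y))

  *-monoˡ-< : 0# < z → x < y → x * z < y * z
  *-monoˡ-< {z} {x} {y} 0<z x<y =
    <-respʳ-≈ split (<-respˡ-≈ (+-identityˡ (x * z)) (+-monoˡ-< (x * z) (*-pos 0<y-x 0<z)))
    where
    0<y-x : 0# < y + - x
    0<y-x = <-respˡ-≈ (-‿inverseʳ x) (+-monoˡ-< (- x) x<y)
    split : (y + - x) * z + x * z ≈ y * z
    split = trans (sym (distribʳ z (y + - x) x))
      (*-congʳ (trans (+-assoc y (- x) x) (trans (+-congˡ (-‿inverseˡ x)) (+-identityʳ y))))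

  *-cancelʳ-< : 0# < z → x * z < y * z → x < y
  *-cancelʳ-< {z} 0<z lt =
    <-respʳ-≈ (cancel _) (<-respˡ-≈ (cancel _) (*-monoˡ-< (inverse-pos z 0<z) lt))
    where
    cancel : ∀ u → u * z * inverse z 0<z ≈ u
    cancel u = trans (*-assoc u z _)
      (trans (*-congˡ (trans (*-comm z _) (inverseˡ z 0<z))) (*-identityʳ u))

  *-monoˡ-≤ : 0# < z → x ≤ y → x * z ≤ y * z
  *-monoˡ-≤ 0<z x≤y yz<xz = x≤y (*-cancelʳ-< 0<z yz<xz)

  -- Unification would otherwise unfold the proof terms inside inverse.
  abstract
    half : Carrier → Carrier
    half x = x / 2# [ 0<2# ]

    half+half : ∀ x → half x + half x ≈ x
    half+half x =
      trans (solve 2 (λ x i → x :* i :+ x :* i := x :* (i :* (con 1 :+ con 1))) refl x (inverse 2# 0<2#))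
            (trans (*-congˡ (inverseˡ 2# 0<2#)) (*-identityʳ x))

    midpoint : x < y → ∃[ m ] x < m × m < y
    midpoint {x} {y} x<y = half (x + y) , double-cancel-< lower , double-cancel-< upper
      where
      lower : x + x < half (x + y) + half (x + y)
      lower = <-respʳ-≈ (sym (half+half (x + y))) (+-monoʳ-< x x<y)
      upper : half (x + y) + half (x + y) < y + y
      upper = <-respˡ-≈ (sym (half+half (x + y))) (+-monoˡ-< y x<y)

  -- The order is not decidable, so the larger of `x` and `y` cannot be selected. Two points `n < m`
  -- between `x` and `z` leave a gap against which cotransitivity tests `y`: above `n`, a midpoint
  -- of `y` and `z` also exceeds `x`; below `m`, the point `m` serves.
  common-midpoint : ∀ {x y z} → x < z → y < z → ∃[ m ] x < m × y < m × m < z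
  common-midpoint {x} {y} {z} x<z y<z =
    let n  , x<n  , n<z  = midpoint x<z
        m  , n<m  , m<z  = midpoint n<z
        m′ , y<m′ , m′<z = midpoint y<z
    in [ (λ n<y → m′ , <-trans x<n (<-trans n<y y<m′) , y<m′ , m′<z)
       , (λ y<m → m , <-trans x<n n<m , y<m , m<z) ]′ (<-cotrans n<m y)

  open SemiringMult semiring public using () renaming (_×_ to _·_; ×-homo-+ to ·-homo-+; ×-comm-* to ·-comm-*)

  ·-monoˡ-≤ : 0# ≤ x → ∀ {m n} → m ℕ.≤ n → m · x ≤ n · x
  ·-monoˡ-≤ 0≤x {n = zero}  z≤n       = ≤-reflexive refl
  ·-monoˡ-≤ 0≤x {n = suc n} z≤n       =
    ≤-trans (≤-reflexive (sym (+-identityˡ 0#))) (+-mono-≤ 0≤x (·-monoˡ-≤ 0≤x {n = n} z≤n))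
  ·-monoˡ-≤ 0≤x             (s≤s m≤n) = +-mono-≤ (≤-reflexive refl) (·-monoˡ-≤ 0≤x m≤n)

-- Makespan, migration and jobs too large to migrate.

module SchedulingProperties {c ℓ₁ ℓ₂} (F : OrderedField c ℓ₁ ℓ₂) where
  open OrderedField F
  open OrderedFieldProperties F
  open Scheduling F

  load≤makespan : ∀ m {js} (σ : Schedule js) → load m σ ≤ makespan σ
  load≤makespan m₁ σ = proj₁ (⊔-supremum (load m₁ σ) (load m₂ σ))
  load≤makespan m₂ σ = proj₁ (proj₂ (⊔-supremum (load m₁ σ) (load m₂ σ)))

  0≤migrated : ∀ {js} (σ τ : Schedule js) → 0# ≤ migrated σ τ
  0≤migrated [] [] = ≤-reflexive refl
  0≤migrated (_∷_ {x = j} (m , _) σ) ((m′ , _) ∷ τ) =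
    ≤-trans (≤-reflexive (sym (+-identityˡ 0#))) (+-mono-≤ (first m m′) (0≤migrated σ τ))
    where
    first : ∀ m m′ → 0# ≤ (if does (m ≟ m′) then 0# else size j)
    first m₁ m₁ = ≤-reflexive refl
    first m₁ m₂ = <⇒≤ (size-pos j)
    first m₂ m₁ = <⇒≤ (size-pos j)
    first m₂ m₂ = ≤-reflexive refl

  CanProcess-irrelevant : ∀ {m g} (p q : m CanProcess g) → p ≡ q
  CanProcess-irrelevant m₁-any m₁-any = ≡-refl
  CanProcess-irrelevant m₂-two m₂-two = ≡-refl

  m₂-only-two : ∀ {g} → m₂ CanProcess g → g ≡ gos₂
  m₂-only-two m₂-two = ≡-refl

  -- Only GoS 2 is constrained: a GoS 1 job has `m₁` as its sole machine and stays there whatever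
  -- its size.
  Immovable : Carrier → Job → Set ℓ₂
  Immovable z j = gos j ≡ gos₂ → z < size j

  -- A single job changing machine already contributes more than `z`, as the remaining migration is
  -- nonnegative. Eligibility proofs are unique, so the schedules are equal as terms and facts
  -- transfer by `subst`.
  immovable⇒same-schedule : ∀ {z js} → All (Immovable z) js → (σ τ : Schedule js) →
                            migrated σ τ ≤ z → σ ≡ τ
  immovable⇒same-schedule []             []            []            _  = ≡-refl
  immovable⇒same-schedule {z} {j ∷ _} (z<j ∷ z<js) ((m , p) ∷ σ) ((m′ , q) ∷ τ) le = by-cases m m′ p q le
    where
    rest : 0# + migrated σ τ ≤ z → σ ≡ τ
    rest le = immovable⇒same-schedule z<js σ τ (≤-trans (≤-reflexive (sym (+-identityˡ (migrated σ τ)))) le)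

    moved : gos j ≡ gos₂ → ¬ (size j + migrated σ τ ≤ z)
    moved two le = ≤-trans (≤-trans (≤-reflexive (sym (+-identityʳ (size j))))
                                    (+-mono-≤ (≤-reflexive refl) (0≤migrated σ τ))) le (z<j two)

    by-cases : ∀ m m′ (p : m CanProcess gos j) (q : m′ CanProcess gos j) →
               migrated {j ∷ _} ((m , p) ∷ σ) ((m′ , q) ∷ τ) ≤ z →
               _≡_ {A = Schedule (j ∷ _)} ((m , p) ∷ σ) ((m′ , q) ∷ τ)
    by-cases m₁ m₁ p q le = cong₂ (λ p τ → (m₁ , p) ∷ τ) (CanProcess-irrelevant p q) (rest le)
    by-cases m₂ m₂ p q le = cong₂ (λ p τ → (m₂ , p) ∷ τ) (CanProcess-irrelevant p q) (rest le)
    by-cases m₁ m₂ p q le = ⊥-elim (moved (m₂-only-two q) le)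
    by-cases m₂ m₁ p q le = ⊥-elim (moved (m₂-only-two p) le)

module LowerBound {c ℓ₁ ℓ₂} (F : OrderedField c ℓ₁ ℓ₂) where
  open OrderedField F
  open OrderedFieldProperties F
  open Scheduling F
  open SchedulingProperties F

  -- Sizes and loads as natural combinations of two positive quantities.

  module Weighted {h t : Carrier} (0<h : 0# < h) (0<t : 0# < t) where
    open CommutativeSemigroupProperties (CommutativeRing.+-commutativeSemigroup commutativeRing)
      using (interchange)

    -- All sizes are expressed by h = e/2 and t = 1 - 8h as n h + k t with natural
    -- n and k, so that loads are compared by computation: 1 is (8 , 1) and 1 + e
    -- is (10 , 1).
    Weight : Set
    Weight = ℕ × ℕ

    ⟦_⟧ : Weight → Carrier
    ⟦ n , k ⟧ = n · h + k · t

    _+ᵂ_ : Weight → Weight → Weight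
    (n , k) +ᵂ (n′ , k′) = n ℕ.+ n′ , k ℕ.+ k′

    _≤ᵂ_ : Weight → Weight → Set
    (n , k) ≤ᵂ (n′ , k′) = n ℕ.≤ n′ × k ℕ.≤ k′

    _≤ᵂ?_ : ∀ v w → Dec (v ≤ᵂ w)
    (n , k) ≤ᵂ? (n′ , k′) = (n ℕ.≤? n′) ×-dec (k ℕ.≤? k′)

    ⟦⟧-homo-+ : ∀ v w → ⟦ v +ᵂ w ⟧ ≈ ⟦ v ⟧ + ⟦ w ⟧
    ⟦⟧-homo-+ (n , k) (n′ , k′) =
      trans (+-cong (·-homo-+ h n n′) (·-homo-+ t k k′)) (interchange (n · h) (n′ · h) (k · t) (k′ · t))

    ⟦⟧-mono-≤ : ∀ {v w} → v ≤ᵂ w → ⟦ v ⟧ ≤ ⟦ w ⟧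
    ⟦⟧-mono-≤ (n≤ , k≤) = +-mono-≤ (·-monoˡ-≤ (<⇒≤ 0<h) n≤) (·-monoˡ-≤ (<⇒≤ 0<t) k≤)

    ⟦⟧-pos : ∀ n {k} .{{_ : NonZero n}} → 0# < ⟦ n , k ⟧
    ⟦⟧-pos n@(suc _) {k} = <-≤-trans (<-respʳ-≈ h≈ 0<h) (⟦⟧-mono-≤ {1 , 0} {n , k} (s≤s z≤n , z≤n))
      where
      h≈ : h ≈ ⟦ 1 , 0 ⟧
      h≈ = sym (trans (+-identityʳ (h + 0#)) (+-identityʳ h))

    weighted : (w : Weight) → GoS → .{{NonZero (proj₁ w)}} → Job
    weighted (n , k) g = job ⟦ n , k ⟧ (⟦⟧-pos n {k}) g

    -- Reads a job sequence as a list of weights. With closed weights and known machines, `loadᵂ`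
    -- evaluates to a pair of numerals.
    data Weights : Jobs → Set (c ⊔ˡ ℓ₂) where
      []  : Weights []
      _∷_ : ∀ {js g} w {p : 0# < ⟦ w ⟧} → Weights js → Weights (job ⟦ w ⟧ p g ∷ js)

    loadᵂ : Machine → ∀ {js} → Weights js → Schedule js → Weight
    loadᵂ m []       []             = 0 , 0
    loadᵂ m (w ∷ ws) ((m′ , _) ∷ σ) = (if does (m ≟ m′) then w else (0 , 0)) +ᵂ loadᵂ m ws σ

    load≈⟦loadᵂ⟧ : ∀ m {js} (ws : Weights js) (σ : Schedule js) → load m σ ≈ ⟦ loadᵂ m ws σ ⟧
    load≈⟦loadᵂ⟧ m []       []             = sym (+-identityˡ 0#)
    load≈⟦loadᵂ⟧ m (w ∷ ws) ((m′ , _) ∷ σ) =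
      trans (+-cong (first m m′) (load≈⟦loadᵂ⟧ m ws σ))
            (sym (⟦⟧-homo-+ (if does (m ≟ m′) then w else (0 , 0)) (loadᵂ m ws σ)))
      where
      first : ∀ m m′ → (if does (m ≟ m′) then ⟦ w ⟧ else 0#) ≈ ⟦ if does (m ≟ m′) then w else (0 , 0) ⟧
      first m₁ m₁ = refl
      first m₁ m₂ = sym (+-identityˡ 0#)
      first m₂ m₁ = sym (+-identityˡ 0#)
      first m₂ m₂ = refl

    makespan-≥ : ∀ m {js} (ws : Weights js) (σ : Schedule js) {w} → w ≤ᵂ loadᵂ m ws σ → ⟦ w ⟧ ≤ makespan σ
    makespan-≥ m ws σ w≤ = ≤-trans (⟦⟧-mono-≤ w≤)
      (≤-trans (≤-reflexive (sym (load≈⟦loadᵂ⟧ m ws σ))) (load≤makespan m σ))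

    makespan-≤ : ∀ {js} (ws : Weights js) (σ : Schedule js) {w} →
                 loadᵂ m₁ ws σ ≤ᵂ w → loadᵂ m₂ ws σ ≤ᵂ w → makespan σ ≤ ⟦ w ⟧
    makespan-≤ ws σ {w} w≥₁ w≥₂ = proj₂ (proj₂ (⊔-supremum _ _)) ⟦ w ⟧ (bound m₁ w≥₁) (bound m₂ w≥₂)
      where
      bound : ∀ m → loadᵂ m ws σ ≤ᵂ w → load m σ ≤ ⟦ w ⟧
      bound m w≥ = ≤-trans (≤-reflexive (load≈⟦loadᵂ⟧ m ws σ)) (⟦⟧-mono-≤ w≥)

    -- The hidden `True` argument is found by evaluating the decision, so a case on concrete
    -- machines needs only the name of an overloaded machine.
    data Reaches (w : Weight) {js} (ws : Weights js) (σ : Schedule js) : Set where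
      on : ∀ m {_ : True (w ≤ᵂ? loadᵂ m ws σ)} → Reaches w ws σ

    reaches⇒makespan-≥ : ∀ {w js} {ws : Weights js} {σ} → Reaches w ws σ → ⟦ w ⟧ ≤ makespan σ
    reaches⇒makespan-≥ {ws = ws} {σ} (on m {ok}) = makespan-≥ m ws σ (toWitness ok)

    optimal : ∀ {js} (ws : Weights js) (σ : Schedule js) {w} →
              loadᵂ m₁ ws σ ≤ᵂ w → loadᵂ m₂ ws σ ≤ᵂ w → (∀ τ → Reaches w ws τ) →
              ∀ {z} → z ≈ ⟦ w ⟧ → IsOptimalMakespan js z
    optimal ws σ w≥₁ w≥₂ all-reach z≈w =
      (σ , ≤-antisym (≤-trans (makespan-≤ ws σ w≥₁ w≥₂) (≤-reflexive (sym z≈w))) (z≤ σ)) , z≤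
      where
      z≤ : ∀ τ → _ ≤ makespan τ
      z≤ τ = ≤-trans (≤-reflexive z≈w) (reaches⇒makespan-≥ (all-reach τ))

  -- The adversary's inputs and the forced makespan.

  module Adversary {h t M : Carrier} (0<h : 0# < h) (0<t : 0# < t)
                   (1≈8h+t : 1# ≈ 8 · h + 1 · t) (2Mh<5h+t : 2 · (M * h) < 5 · h + 1 · t) where
    open Weighted 0<h 0<t

    -- With `e = 2h` and `t = 1 - 4e`, the sizes are `e`, `1 - 2e`, `1 - e`, `e/2` and `2e`, in this
    -- order.
    first small large tiny filler : Job
    first  = weighted (2 , 0) gos₁
    small  = weighted (4 , 1) gos₂
    large  = weighted (6 , 1) gos₂
    tiny   = weighted (1 , 0) gos₁
    filler = weighted (4 , 0) gos₂

    opening pinned filled : Jobs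
    opening = large ∷ small ∷ first ∷ []
    pinned  = tiny ∷ tiny ∷ opening
    filled  = filler ∷ opening

    pattern on₁ = m₁ , m₁-any
    pattern on₂ = m₂ , m₂-two

    opening-weights : Weights opening
    opening-weights = (6 , 1) ∷ (4 , 1) ∷ (2 , 0) ∷ []

    pinned-weights : Weights pinned
    pinned-weights = (1 , 0) ∷ (1 , 0) ∷ opening-weights

    filled-weights : Weights filled
    filled-weights = (4 , 0) ∷ opening-weights

    ≤ᵂ-auto : ∀ {v w} {_ : True (v ≤ᵂ? w)} → v ≤ᵂ w
    ≤ᵂ-auto {_} {_} {ok} = toWitness ok

    -- All jobs but `large` sum to exactly 1 and fit on `m₁`. The GoS 1 jobs take `4h` of `m₁`, so
    -- either GoS 2 job brings it to at least 1; with both on `m₂`, that machine exceeds 1.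
    pinned-complete : CompleteInput pinned
    pinned-complete = optimal pinned-weights (on₁ ∷ on₁ ∷ on₂ ∷ on₁ ∷ on₁ ∷ []) ≤ᵂ-auto ≤ᵂ-auto reach 1≈8h+t
      where
      reach : ∀ τ → Reaches (8 , 1) pinned-weights τ
      reach (on₁ ∷ on₁ ∷ on₁ ∷ on₁ ∷ on₁ ∷ []) = on m₁
      reach (on₁ ∷ on₁ ∷ on₂ ∷ on₁ ∷ on₁ ∷ []) = on m₁
      reach (on₁ ∷ on₁ ∷ on₁ ∷ on₂ ∷ on₁ ∷ []) = on m₁
      reach (on₁ ∷ on₁ ∷ on₂ ∷ on₂ ∷ on₁ ∷ []) = on m₂

    -- The four sizes sum to 2, and pairing `large` with `first` and `small` with `filler` balances
    -- the machines exactly.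
    filled-complete : CompleteInput filled
    filled-complete = optimal filled-weights (on₂ ∷ on₁ ∷ on₂ ∷ on₁ ∷ []) ≤ᵂ-auto ≤ᵂ-auto reach 1≈8h+t
      where
      reach : ∀ τ → Reaches (8 , 1) filled-weights τ
      reach (on₁ ∷ on₁ ∷ on₁ ∷ on₁ ∷ []) = on m₁
      reach (on₁ ∷ on₁ ∷ on₂ ∷ on₁ ∷ []) = on m₁
      reach (on₁ ∷ on₂ ∷ on₁ ∷ on₁ ∷ []) = on m₁
      reach (on₁ ∷ on₂ ∷ on₂ ∷ on₁ ∷ []) = on m₂
      reach (on₂ ∷ on₁ ∷ on₁ ∷ on₁ ∷ []) = on m₁
      reach (on₂ ∷ on₁ ∷ on₂ ∷ on₁ ∷ []) = on m₁
      reach (on₂ ∷ on₂ ∷ on₁ ∷ on₁ ∷ []) = on m₂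
      reach (on₂ ∷ on₂ ∷ on₂ ∷ on₁ ∷ []) = on m₂

    -- The two `tiny` jobs are included in advance. With `large` on `m₁` and `small` on `m₂`, they
    -- bring `m₁` to exactly `(10 , 1)`; two GoS 2 jobs sharing a machine already weigh `(10 , 2)`.
    opening-dichotomy : ∀ σ → σ ≡ on₂ ∷ on₁ ∷ on₁ ∷ [] ⊎ Reaches (10 , 1) pinned-weights (on₁ ∷ on₁ ∷ σ)
    opening-dichotomy (on₂ ∷ on₁ ∷ on₁ ∷ []) = inj₁ ≡-refl
    opening-dichotomy (on₁ ∷ on₁ ∷ on₁ ∷ []) = inj₂ (on m₁)
    opening-dichotomy (on₁ ∷ on₂ ∷ on₁ ∷ []) = inj₂ (on m₁)
    opening-dichotomy (on₂ ∷ on₂ ∷ on₁ ∷ []) = inj₂ (on m₂)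

    M*⟦n,0⟧ : ∀ n → M * ⟦ n , 0 ⟧ ≈ n · (M * h)
    M*⟦n,0⟧ n = trans (*-congˡ (+-identityʳ (n · h))) (·-comm-* n M h)

    -- Doubling matches the hypothesis on `2Mh`: `2Mh < 5h + t ≤ 2(4h + t)`.
    tiny-moves-<small : M * size tiny < size small
    tiny-moves-<small = double-cancel-<
      (<-respˡ-≈ (trans (·-homo-+ (M * h) 1 1) (+-cong (sym (M*⟦n,0⟧ 1)) (sym (M*⟦n,0⟧ 1))))
        (<-respʳ-≈ (⟦⟧-homo-+ (4 , 1) (4 , 1)) (<-≤-trans 2Mh<5h+t (⟦⟧-mono-≤ {5 , 1} {8 , 2} ≤ᵂ-auto))))

    -- Two copies of the hypothesis give `4Mh < 10h + 2t`, and `10 = 6 + 4` splits this into the two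
    -- sizes.
    filler-moves-<small+large : M * size filler < size large + size small
    filler-moves-<small+large =
      <-respˡ-≈ (trans (sym (·-homo-+ (M * h) 2 2)) (sym (M*⟦n,0⟧ 4)))
        (<-respʳ-≈ (trans (sym (⟦⟧-homo-+ (5 , 1) (5 , 1))) (⟦⟧-homo-+ (6 , 1) (4 , 1)))
          (+-mono-< 2Mh<5h+t 2Mh<5h+t))

    opening-immovable : All (Immovable (M * size tiny)) opening
    opening-immovable =
      (λ _ → <-≤-trans tiny-moves-<small (⟦⟧-mono-≤ {4 , 1} {6 , 1} ≤ᵂ-auto)) ∷ (λ _ → tiny-moves-<small) ∷ (λ ()) ∷ []

    filled-reaches : ∀ (τ : Schedule filled) → migrated (on₂ ∷ on₁ ∷ on₁ ∷ []) (tail τ) ≤ M * size filler →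
                     Reaches (10 , 1) filled-weights τ
    filled-reaches (on₁ ∷ on₁ ∷ on₁ ∷ on₁ ∷ []) _ = on m₁
    filled-reaches (on₂ ∷ on₁ ∷ on₁ ∷ on₁ ∷ []) _ = on m₁
    filled-reaches (on₁ ∷ on₂ ∷ on₁ ∷ on₁ ∷ []) _ = on m₁
    filled-reaches (on₂ ∷ on₂ ∷ on₁ ∷ on₁ ∷ []) _ = on m₂
    filled-reaches (on₁ ∷ on₂ ∷ on₂ ∷ on₁ ∷ []) _ = on m₂
    filled-reaches (on₂ ∷ on₂ ∷ on₂ ∷ on₁ ∷ []) _ = on m₂
    -- Here `large` and `small` have exchanged machines, so both count as migrated, which exceeds
    -- the budget of `filler`.
    filled-reaches (_   ∷ on₁ ∷ on₂ ∷ on₁ ∷ []) le =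
      ⊥-elim (≤-trans (≤-reflexive (+-congˡ small≈)) le filler-moves-<small+large)
      where
      small≈ : size small ≈ size small + (0# + 0#)
      small≈ = sym (trans (+-congˡ (+-identityˡ 0#)) (+-identityʳ (size small)))

    pinned-reaches : ∀ {σ : Schedule opening} (τ : Schedule (tiny ∷ opening)) (υ : Schedule pinned) →
                     migrated σ (tail τ) ≤ M * size tiny → migrated τ (tail υ) ≤ M * size tiny →
                     Reaches (10 , 1) pinned-weights (on₁ ∷ on₁ ∷ σ) → Reaches (10 , 1) pinned-weights υ
    pinned-reaches {σ} (on₁ ∷ τ) (on₁ ∷ υ) le₁ le₂ =
      subst (λ τ → Reaches (10 , 1) pinned-weights (on₁ ∷ τ)) (≡-trans (cong (on₁ ∷_) σ≡τ) τ≡υ)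
      where
      σ≡τ : σ ≡ τ
      σ≡τ = immovable⇒same-schedule opening-immovable σ τ le₁

      τ≡υ : on₁ ∷ τ ≡ υ
      τ≡υ = immovable⇒same-schedule ((λ ()) ∷ opening-immovable) (on₁ ∷ τ) υ le₂

    forced : (A : Algorithm M) → ∃[ js ] CompleteInput js × ⟦ 10 , 1 ⟧ ≤ makespan (schedule A js)
    forced A = [ fill , pin ]′ (opening-dichotomy (schedule A opening))
      where
      fill : schedule A opening ≡ on₂ ∷ on₁ ∷ on₁ ∷ [] → _
      fill split = filled , filled-complete , reaches⇒makespan-≥ (filled-reaches (schedule A filled)
        (subst (λ σ → migrated σ (tail (schedule A filled)) ≤ M * size filler) split
          (migration-bounded A filler opening ([] , filled-complete))))

      pin : Reaches (10 , 1) pinned-weights (on₁ ∷ on₁ ∷ schedule A opening) → _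
      pin reaches = pinned , pinned-complete , reaches⇒makespan-≥
        (pinned-reaches (schedule A (tiny ∷ opening)) (schedule A pinned)
          -- After the first `tiny` the input is not yet complete; the second one is the
          -- continuation that makes the migration bound applicable.
          (migration-bounded A tiny opening (tiny ∷ [] , pinned-complete))
          (migration-bounded A tiny (tiny ∷ opening) ([] , pinned-complete)) reaches)

  -- Choice of `h` from `M` and the target ratio.

  module Parameters (M : Carrier) (5/2≤M : 5/2 ≤ M) where
    :2 :3 :5 : ∀ {n} → Polynomial n
    :2 = con 1 :+ con 1
    :3 = :2 :+ con 1
    :5 = :3 :+ :2

    i : Carrier
    i = inverse (2# * M + 3#) (0<2M+3 5/2≤M)

    module _ {h : Carrier} (0<h : 0# < h) (h<i : h < i) where
      t : Carrier
      t = 1# + - (8 · h)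

      dh<1 : (2# * M + 3#) * h < 1#
      dh<1 = <-respˡ-≈ (*-comm h _) (<-respʳ-≈ (inverseˡ _ (0<2M+3 5/2≤M)) (*-monoˡ-< (0<2M+3 5/2≤M) h<i))

      5≤2M : 5# ≤ 2# * M
      5≤2M 2M<5 = 5/2≤M (*-cancelʳ-< 0<2# (<-respʳ-≈ (sym 5/2*2≈5) (<-respˡ-≈ (*-comm 2# M) 2M<5)))
        where
        5/2*2≈5 : 5/2 * 2# ≈ 5#
        5/2*2≈5 = trans (*-assoc 5# _ 2#) (trans (*-congˡ (inverseˡ 2# 0<2#)) (*-identityʳ 5#))

      -- The assumption `M ≥ 5/2` enters as `8 = 5 + 3 ≤ 2M + 3`, whence `8h ≤ (2M + 3)h < 1`; this
      -- makes `t` positive.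
      8h<1 : 8 · h < 1#
      8h<1 = ≤-<-trans (≤-trans (≤-reflexive 8h≈) (*-monoˡ-≤ 0<h (+-mono-≤ 5≤2M (≤-reflexive refl)))) dh<1
        where
        8h≈ : 8 · h ≈ (5# + 3#) * h
        8h≈ = solve 1 (λ h → 8 :× h := (:5 :+ :3) :* h) refl h

      0<t : 0# < t
      0<t = <-respˡ-≈ (-‿inverseʳ (8 · h)) (+-monoˡ-< (- (8 · h)) 8h<1)

      1≈8h+t : 1# ≈ 8 · h + 1 · t
      1≈8h+t = sym (trans (+-congˡ (+-identityʳ t)) (trans (+-comm (8 · h) t)
        (trans (+-assoc 1# _ _) (trans (+-congˡ (-‿inverseˡ (8 · h))) (+-identityʳ 1#)))))

      -- This is `(2M + 3)h < 1 = 8h + t` with `3h` cancelled.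
      2Mh<5h+t : 2 · (M * h) < 5 · h + 1 · t
      2Mh<5h+t = +-cancelʳ-< (3 · h) (<-respˡ-≈
        (solve 2 (λ m h → (:2 :* m :+ :3) :* h := 2 :× (m :* h) :+ 3 :× h) refl M h)
        (<-respʳ-≈ (trans 1≈8h+t (solve 2 (λ h t → 8 :× h :+ 1 :× t := 5 :× h :+ 1 :× t :+ 3 :× h) refl h t))
          dh<1))

      1+2h≈ : 1# + 2 · h ≈ 10 · h + 1 · t
      1+2h≈ = trans (+-congʳ 1≈8h+t)
        (solve 2 (λ h t → 8 :× h :+ 1 :× t :+ 2 :× h := 10 :× h :+ 1 :× t) refl h t)

    -- The solution `u` of `1 + 2u = x` lies below `i` but may be negative, so `h` is chosen above
    -- both 0 and `u`.
    h-exists : ∀ {x} → x < 1# + 2# * i → ∃[ h ] 0# < h × h < i × x < 1# + 2 · h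
    h-exists {x} x<r =
      let h , 0<h , u<h , h<i = common-midpoint (inverse-pos _ (0<2M+3 5/2≤M)) u<i in
      h , 0<h , h<i , <-respʳ-≈ (+-congˡ (+-congˡ (sym (+-identityʳ h))))
                        (<-respˡ-≈ 1+u+u≈x (+-monoʳ-< 1# (+-mono-< u<h u<h)))
      where
      u = half (x + - 1#)

      1+u+u≈x : 1# + (u + u) ≈ x
      1+u+u≈x = trans (+-congˡ (half+half (x + - 1#))) (trans (+-comm 1# _)
        (trans (+-assoc x _ _) (trans (+-congˡ (-‿inverseˡ 1#)) (+-identityʳ x))))

      u<i : u < i
      u<i = double-cancel-< (+-cancelʳ-< 1# (<-respˡ-≈ (trans (sym 1+u+u≈x) (+-comm 1# _))
        (<-respʳ-≈ (solve 1 (λ i → con 1 :+ :2 :* i := i :+ i :+ con 1) refl i) x<r)))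

-- The ratio as a supremum over `h < i`, and its closed form.

mainTheorem4 : ∀ {c ℓ₁ ℓ₂} (F : OrderedField c ℓ₁ ℓ₂) →
    let open OrderedField F
        open Scheduling F in
    (M : Carrier) (5/2≤M : 5/2 ≤ M) →
    let 0<d = 0<2M+3 5/2≤M
        r   = 1# + 2# / (2# * M + 3#) [ 0<d ] in
    (∀ (A : Algorithm M) → CompetitiveRatio A AtLeast r)
    × r ≈ (2# * M + 5#) / (2# * M + 3#) [ 0<d ]
mainTheorem4 F M 5/2≤M = lower-bound , r≈
  where
  open OrderedField F
  open OrderedFieldProperties F
  open Scheduling F
  open LowerBound F
  open Parameters M 5/2≤M

  lower-bound : ∀ (A : Algorithm M) → CompetitiveRatio A AtLeast (1# + 2# * i)
  lower-bound A x x<r =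
    let h , 0<h , h<i , x<1+2h = h-exists x<r
        js , complete , 1+2h≤makespan =
          Adversary.forced 0<h (0<t 0<h h<i) (1≈8h+t 0<h h<i) (2Mh<5h+t 0<h h<i) A
    in js , complete , <-≤-trans (<-respʳ-≈ (1+2h≈ 0<h h<i) x<1+2h) 1+2h≤makespan

  r≈ : 1# + 2# * i ≈ (2# * M + 5#) * i
  r≈ = trans (+-congʳ (sym (trans (*-comm _ i) (inverseˡ _ (0<2M+3 5/2≤M)))))
    (solve 2 (λ m i → (:2 :* m :+ :3) :* i :+ :2 :* i := (:2 :* m :+ :5) :* i) refl M i)
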